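{- Let $n\ge 3$ be an integer and let $K=\{123,231\}\{213,132\}$. The number of equivalence classes of $S_n$ under $K$-equivalence is $n^2-3n+4$.
   Context: Permutations in $S_n$ are written as words $\pi_1\pi_2\cdots\pi_n$ in one-line notation. The order permutation of a word $u$ of $c$ distinct positive integers is the unique $\sigma\in S_c$ with $\sigma_i<\sigma_j$ iff $u_i<u_j$. A replacement partition $K$ of $S_c$ is a set partition of $S_c$; it is denoted by listing its parts with the one-element parts (and outer brackets) omitted, so here $K$ is the set partition of $S_3$ whose only parts of size greater than one are $\{123,231\}$ and $\{213,132\}$. The $K$-equivalence on $S_n$ is the equivalence relation generated by: $\phi\equiv\psi$ whenever $\phi=aub$ and $\psi=avb$ (concatenations) for some possibly empty words $a,b$ and words $u,v$ of length $c$ (so $u,v$ occupy the same $c$ consecutive positions) such that the order permutations of $u$ and $v$ lie in the same part of $K$. All equivalence classes are counted, including one-element classes. -}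

module Defs where

open import Data.Fin using (Fin; toℕ) renaming (_<_ to _<ᶠ_)
open import Data.Fin.Permutation using (Permutation′; _⟨$⟩ʳ_)
open import Data.List using (List; []; _∷_; _++_)
open import Data.List.Membership.Propositional using (_∈_)
open import Data.List.Relation.Unary.Any using (Any)
open import Data.Nat using (ℕ; suc; _<_)
open import Data.Product using (_×_; ∃-syntax)
open import Data.Sum using (_⊎_)
open import Data.Vec using (Vec; []; _∷_; lookup; tabulate; toList)
open import Function.Bundles using (Bijection; _⇔_)
open import Level using (0ℓ)
open import Relation.Binary.Bundles using (Setoid)
open import Relation.Binary.Construct.Closure.Equivalence using (setoid)
open import Relation.Binary.PropositionalEquality as ≡ using (_≡_)

-- `Fin n` stands for {1,…,n}, so letters are shifted by one.
oneLine : ∀ {n} → Permutation′ n → Vec ℕ n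
oneLine π = tabulate (λ i → suc (toℕ (π ⟨$⟩ʳ i)))

IsOrderPermutation : ∀ {c} → Vec ℕ c → Permutation′ c → Set
IsOrderPermutation u σ =
  ∀ i j → (σ ⟨$⟩ʳ i <ᶠ σ ⟨$⟩ʳ j) ⇔ (lookup u i < lookup u j)

-- A set partition of S_c, given by the list of its parts of size greater than
-- one, each part being a list of permutations in one-line notation.  The listed
-- parts are meant to be disjoint; permutations in no listed part form
-- one-element parts.
ReplacementPartition : ℕ → Set
ReplacementPartition c = List (List (Vec ℕ c))

SamePart : ∀ {c} → ReplacementPartition c → Permutation′ c → Permutation′ c → Set
SamePart K σ τ =
  oneLine σ ≡ oneLine τ ⊎ Any (λ P → oneLine σ ∈ P × oneLine τ ∈ P) K

Replace : ∀ {c} → ReplacementPartition c → ∀ {n} →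
          Permutation′ n → Permutation′ n → Set
Replace {c} K φ ψ =
  ∃[ a ] ∃[ b ] ∃[ u ] ∃[ v ] ∃[ σ ] ∃[ τ ]
    toList (oneLine φ) ≡ a ++ toList {n = c} u ++ b ×
    toList (oneLine ψ) ≡ a ++ toList {n = c} v ++ b ×
    IsOrderPermutation u σ ×
    IsOrderPermutation v τ ×
    SamePart K σ τ

-- For n ≥ c, taking u = v shows that pointwise equal permutations are related,
-- so the classes do not depend on how a permutation is presented.
KEquivalence : ∀ {c} → ReplacementPartition c → ℕ → Setoid 0ℓ 0ℓ
KEquivalence K n = setoid (Replace K {n})

K : ReplacementPartition 3
K = ((1 ∷ 2 ∷ 3 ∷ []) ∷ (2 ∷ 3 ∷ 1 ∷ []) ∷ [])
  ∷ ((2 ∷ 1 ∷ 3 ∷ []) ∷ (1 ∷ 3 ∷ 2 ∷ []) ∷ [])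
  ∷ []

-- A setoid bijection onto `Fin N` is a bijection from the set of equivalence
-- classes onto an N-element set.
HasClassCount : Setoid 0ℓ 0ℓ → ℕ → Set
HasClassCount S N = Bijection S (≡.setoid (Fin N))

{-# OPTIONS --safe #-}
module Submission where

-- In both nontrivial parts of K the two words are  x y m  and  y m x  with m the
-- largest letter.  So the equivalence is generated by the rotations
--
--     … x y m …  →  … y m x …        (x < m, y < m),
--
-- that is: a pair y m with y < m commutes with every letter smaller than m.
--
-- Let n be the largest letter of a word w.
--  * If w begins with n, no rotation ever touches this n, and the classes of such
--    words are the classes of S_(n-1).
--  * Otherwise n has a predecessor y, and the block y n commutes with every other
--    letter.  Delete the block and count how many of the letters n-1, n-2, …, 3
--    the remaining word begins with, in this order and without gaps.  This number
--    j, with 0 ≤ j ≤ n-3, and the sign of w are invariant (`shape-step`,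
--    `sign-step`).  Conversely they determine the class: write the word as r y n
--    and strip the j leading letters, which are common to all words concerned.
--    If more than two letters of {1,…,M} are left in r y, where M is the largest of
--    them, then M does not begin r, and rotations through n can bring M to the place
--    just before the final n (`state-inner`).  Any three consecutive letters in
--    front of M n can then be permuted cyclically (`cycle-foot`), which leaves only
--    the order of the letters 1 and 2 undecided (`cycle-sort`).
-- There are thus 2 (n-2) classes of the second kind, and adding up the two kinds,
-- from the two classes of S_2 on, gives n² - 3n + 4.
--
-- Words are lists of letters; the length is written 2 + k.  `complete` brings every
-- word to one of two canonical words of its shape, which have opposite signs
-- (`canonical-sign`), and `shape-canon` shows that every shape occurs.
-- `replace-words` and `lift` translate between permutations and words.

open import Defs
open import Data.Bool using (Bool; true; false; not; _xor_)
open import Data.Bool.Properties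
  using (not-involutive; not-distribˡ-xor; not-distribʳ-xor; xor-assoc; xor-comm; xor-identityʳ; xor-same)
open import Data.Fin using (Fin; zero; suc; toℕ; cast) renaming (_<_ to _<ᶠ_)
open import Data.Fin.Patterns using (0F; 1F; 2F)
open import Data.Fin.Permutation as Perm
  using (Permutation′; permutation; _⟨$⟩ʳ_; _⟨$⟩ˡ_; inverseˡ; inverseʳ; transpose; reverse; cast-id; flip; _∘ₚ_)
import Data.Fin.Properties as Finₚ
open import Data.List as List using (List; []; _∷_; _++_; _∷ʳ_; length)
open import Data.List.Membership.Propositional using (_∈_)
open import Data.List.Membership.Propositional.Properties using (∈-∃++; ∈-tabulate⁺)
open import Data.List.Membership.Propositional.Properties.WithK using (unique∧set⇒bag)
open import Data.List.Properties as Listₚ using (++-assoc; ++-identityʳ)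
open import Data.List.Relation.Binary.BagAndSetEquality using (∼bag⇒↭)
open import Data.List.Relation.Binary.Equality.Propositional using (≋⇒≡)
open import Data.List.Relation.Binary.Permutation.Propositional
  using (_↭_; prep; swap; ↭-refl; ↭-sym; ↭-trans; ↭-reflexive; ↭-isEquivalence; ↭⇒↭ₛ)
open import Data.List.Relation.Binary.Permutation.Propositional.Properties
  using (All-resp-↭; ∈-resp-↭; drop-∷; drop-mid; shift; ++-comm; ++⁺ʳ; map⁺; ∷↭∷ʳ;
         ↭-singleton-inv; ¬x∷xs↭[]; ↭-length)
open import Data.List.Relation.Unary.All as All using (All; []; _∷_)
open import Data.List.Relation.Unary.All.Properties using (++⁻ˡ; ++⁻ʳ)
open import Data.List.Relation.Unary.AllPairs using ([]; _∷_)
import Data.List.Relation.Unary.AllPairs.Properties as AllPairs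
open import Data.List.Relation.Unary.Any using (here; there)
open import Data.List.Relation.Unary.Linked.Properties using (AllPairs⇒Linked)
open import Data.List.Relation.Unary.Sorted.TotalOrder.Properties using (↗↭↗⇒≋)
open import Data.List.Relation.Unary.Unique.Propositional using (Unique)
import Data.List.Relation.Unary.Unique.Propositional.Properties as Unique
open import Data.Nat using (ℕ; zero; suc; _≥_; _+_; _*_; _∸_; _^_; _≤_; _<_; z≤n; s≤s; _≟_; _<?_)
open import Data.Nat.Properties
open import Data.Nat.Tactic.RingSolver using (solve-∀)
open import Data.Product using (_×_; _,_; ∃-syntax; proj₂)
open import Data.Product.Function.NonDependent.Propositional using (_×-↔_)
open import Data.Sum as Sum using (_⊎_; inj₁; inj₂; [_,_]′)
open import Data.Sum.Function.Propositional using (_⊎-↔_)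
open import Data.Vec as Vec using (Vec; []; _∷_; lookup; toList)
import Data.Vec.Properties as Vecₚ
open import Function using (_∘_; case_of_; _↔_; mk↔ₛ′; Inverse; Injection; mk⇔; Equivalence)
open import Function.Properties.Inverse using (↔-refl; ↔-sym; ↔-trans; ↔⇒↣)
open import Relation.Binary.Construct.Closure.Equivalence as Eq using (EqClosure)
open import Relation.Binary.Construct.Closure.ReflexiveTransitive using (ε; _◅_; _◅◅_)
open import Relation.Binary.Construct.Closure.Symmetric using (SymClosure; fwd; bwd)
open import Relation.Binary.Definitions using (tri<; tri≈; tri>)
open import Relation.Binary.PropositionalEquality
open import Relation.Nullary using (yes; no; does; contradiction)
open import Relation.Nullary.Decidable using (dec-true; dec-false)

open import Data.List.Relation.Binary.Permutation.Setoid (setoid ℕ) using (onIndices)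
open import Data.List.Relation.Binary.Permutation.Setoid.Properties (setoid ℕ) using (onIndices-lookup)

-- Rotations of words

-- The rotations of the three consecutive letters x y m with m the largest one.
data Rot : List ℕ → List ℕ → Set where
  here  : ∀ {x y m b} → x < m → y < m → Rot (x ∷ y ∷ m ∷ b) (y ∷ m ∷ x ∷ b)
  there : ∀ {c w w′} → Rot w w′ → Rot (c ∷ w) (c ∷ w′)

-- K-equivalence on words.
infix 4 _~_
_~_ : List ℕ → List ℕ → Set
_~_ = EqClosure Rot

~-refl : ∀ {w} → w ~ w
~-refl = ε

~-sym : ∀ {w w′} → w ~ w′ → w′ ~ w
~-sym = Eq.symmetric Rot

rot : ∀ {x y m} b → x < m → y < m → x ∷ y ∷ m ∷ b ~ y ∷ m ∷ x ∷ b
rot b x<m y<m = Eq.return (here x<m y<m)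

infixr 5 _∷~_
_∷~_ : ∀ c {w w′} → w ~ w′ → c ∷ w ~ c ∷ w′
c ∷~ r = Eq.gmap (c ∷_) there r

infixr 5 _++~_
_++~_ : ∀ p {w w′} → w ~ w′ → p ++ w ~ p ++ w′
[]      ++~ r = r
(c ∷ p) ++~ r = c ∷~ (p ++~ r)

-- A pair y m with y < m moves past letters smaller than m.
block-right : ∀ {y m} q s → y < m → All (_< m) q → y ∷ m ∷ q ++ s ~ q ++ y ∷ m ∷ s
block-right []      s y<m []          = ~-refl
block-right (x ∷ q) s y<m (x<m ∷ q<m) =
  ~-sym (rot (q ++ s) x<m y<m) ◅◅ (x ∷~ block-right q s y<m q<m)

Rot⇒↭ : ∀ {w w′} → Rot w w′ → w ↭ w′
Rot⇒↭ (here {x} {y} {m} {b} _ _) = ↭-trans (swap x y ↭-refl) (prep y (swap x m ↭-refl))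
Rot⇒↭ (there r) = prep _ (Rot⇒↭ r)

-- Cyclic permutations of three consecutive letters

data Cycle : List ℕ → List ℕ → Set where
  here  : ∀ {x y z q} → Cycle (x ∷ y ∷ z ∷ q) (z ∷ x ∷ y ∷ q)
  there : ∀ {c w w′} → Cycle w w′ → Cycle (c ∷ w) (c ∷ w′)

-- Equivalence of words under arbitrary 3-cycles of consecutive letters.
infix 4 _≈_
_≈_ : List ℕ → List ℕ → Set
_≈_ = EqClosure Cycle

infixr 5 _∷≈_
_∷≈_ : ∀ c {w w′} → w ≈ w′ → c ∷ w ≈ c ∷ w′
c ∷≈ r = Eq.gmap (c ∷_) there r

Cycle⇒↭ : ∀ {w w′} → Cycle w w′ → w ↭ w′
Cycle⇒↭ (here {x} {y} {z}) = ↭-trans (prep x (swap y z ↭-refl)) (swap x z ↭-refl)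
Cycle⇒↭ (there r) = prep _ (Cycle⇒↭ r)

≈⇒↭ : ∀ {w w′} → w ≈ w′ → w ↭ w′
≈⇒↭ = Eq.fold ↭-isEquivalence Cycle⇒↭

-- A letter moves left two places at a time; the last step may overshoot, so at least
-- three letters are needed.  That the rest is nonempty lets the recursion go on.
to-front : ∀ x p c q → length (p ++ q) ≢ 0 → ∃[ z ] ∃[ r ] x ∷ p ++ c ∷ q ≈ c ∷ z ∷ r
to-front x []           c []      ≢0 = contradiction refl ≢0
to-front x []           c (y ∷ q) _  = y , x ∷ q , bwd here ◅ ε
to-front x (y ∷ [])     c q       _  = x , y ∷ q , fwd here ◅ ε
to-front x (y ∷ y′ ∷ p) c q       _ with z , r , e ← to-front y (y′ ∷ p) c q (λ ()) =
  z , x ∷ r , (x ∷≈ e) ◅◅ bwd here ◅ ε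

-- The word 2+k, …, 3, a, b.  For {a, b} = {1, 2} it lists the letters 1, …, 2+k, and
-- w ↭ descent k 1 2  says that w is the word of a permutation of 1, …, 2+k.
descent : ℕ → ℕ → ℕ → List ℕ
descent zero    a b = a ∷ b ∷ []
descent (suc k) a b = 3 + k ∷ descent k a b

descent-length : ∀ k → length (descent k 1 2) ≡ 2 + k
descent-length zero    = refl
descent-length (suc k) = cong suc (descent-length k)

descent-≤ : ∀ k {a b} → a ≤ 2 → b ≤ 2 → All (_≤ 2 + k) (descent k a b)
descent-≤ zero    a≤2 b≤2 = a≤2 ∷ b≤2 ∷ []
descent-≤ (suc k) a≤2 b≤2 = ≤-refl ∷ All.map m≤n⇒m≤1+n (descent-≤ k a≤2 b≤2)

descent-↭⇒< : ∀ k {w} → w ↭ descent k 1 2 → All (_< 3 + k) w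
descent-↭⇒< k w↭ = All-resp-↭ (↭-sym w↭) (All.map s≤s (descent-≤ k (s≤s z≤n) ≤-refl))

pair-cases : ∀ {w} {a b : ℕ} → w ↭ a ∷ b ∷ [] → w ≡ a ∷ b ∷ [] ⊎ w ≡ b ∷ a ∷ []
pair-cases {[]} p = contradiction (↭-sym p) ¬x∷xs↭[]
pair-cases {x ∷ w} {a} {b} p with ∈-resp-↭ p (here refl)
... | here refl = inj₁ (cong (x ∷_) (↭-singleton-inv (drop-∷ p)))
... | there (here refl) = inj₂ (cong (x ∷_) (↭-singleton-inv (drop-∷ (↭-trans p (swap a b ↭-refl)))))

-- A word of 1, …, 3+k, split at its largest letter.
split : ∀ k {w} → w ↭ descent (suc k) 1 2 → ∃[ p ] ∃[ q ] w ≡ p ++ 3 + k ∷ q × p ++ q ↭ descent k 1 2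
split k w↭ with p , q , refl ← ∈-∃++ (∈-resp-↭ (↭-sym w↭) (here refl)) =
  p , q , refl , drop-mid p [] w↭

-- 3-cycles generate the alternating group, so they sort a word up to one transposition.
cycle-sort : ∀ k {w} → w ↭ descent k 1 2 → w ≈ descent k 1 2 ⊎ w ≈ descent k 2 1
cycle-sort zero w↭ = Sum.map (λ { refl → ε }) (λ { refl → ε }) (pair-cases w↭)
cycle-sort (suc k) {w} w↭ with split k w↭
... | [] , q , refl , q↭ = Sum.map (3 + k ∷≈_) (3 + k ∷≈_) (cycle-sort k q↭)
... | x ∷ p , q , refl , pq↭ with to-front x p (3 + k) q
      (λ ≡0 → case trans (sym (descent-length k)) (trans (sym (↭-length pq↭)) (cong suc ≡0)) of λ ())
... | z , r , e = Sum.map ((e ◅◅_) ∘ (3 + k ∷≈_)) ((e ◅◅_) ∘ (3 + k ∷≈_))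
                    (cycle-sort k (drop-∷ (↭-trans (↭-sym (≈⇒↭ e)) w↭)))

-- Words ending in a letter Y followed by a larger letter M

-- The last letter but one can be exchanged through the block it forms with M: this block
-- travels to the left, takes part in one rotation, and returns with another letter.
rotate-foot : ∀ {x z Y M} q → x < Y → z < Y → Y < M → All (_< M) q →
              x ∷ z ∷ q ++ Y ∷ M ∷ [] ~ z ∷ Y ∷ q ++ x ∷ M ∷ []
rotate-foot {x} {z} {Y} {M} q x<Y z<Y Y<M q<M =
  (x ∷~ z ∷~ ~-sym (block-right q [] Y<M q<M))
  ◅◅ rot (M ∷ q ++ []) x<Y z<Y
  ◅◅ (z ∷~ Y ∷~ block-right q [] (<-trans x<Y Y<M) q<M)

-- In front of Y M, with Y < M both larger than all other letters, three consecutive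
-- letters x z c can be cycled: store x in the block with M, let c pass the pair z Y, and
-- put x back.
cycle-foot : ∀ {w w′ Y M} → Y < M → All (_< Y) w → Cycle w w′ → w ++ Y ∷ M ∷ [] ~ w′ ++ Y ∷ M ∷ []
cycle-foot Y<M (x<Y ∷ z<Y ∷ c<Y ∷ q<Y) (here {x} {z} {c} {q}) =
  rotate-foot (c ∷ q) x<Y z<Y Y<M (<-trans c<Y Y<M ∷ All.map (λ l → <-trans l Y<M) q<Y)
  ◅◅ ~-sym (rot (q ++ x ∷ _ ∷ []) c<Y z<Y)
  ◅◅ (c ∷~ ~-sym (rotate-foot q x<Y z<Y Y<M (All.map (λ l → <-trans l Y<M) q<Y)))
cycle-foot Y<M (_ ∷ w<Y) (there r) = _ ∷~ cycle-foot Y<M w<Y r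

≈-foot : ∀ {w w′ Y M} → Y < M → All (_< Y) w → w ≈ w′ → w ++ Y ∷ M ∷ [] ~ w′ ++ Y ∷ M ∷ []
≈-foot Y<M w<Y ε = ε
≈-foot Y<M w<Y (fwd r ◅ rs) = cycle-foot Y<M w<Y r ◅◅ ≈-foot Y<M (All-resp-↭ (Cycle⇒↭ r) w<Y) rs
≈-foot Y<M w<Y (bwd r ◅ rs) = ~-sym (cycle-foot Y<M w′<Y r) ◅◅ ≈-foot Y<M w′<Y rs
  where w′<Y = All-resp-↭ (↭-sym (Cycle⇒↭ r)) w<Y

-- Shapes and canonical words

-- The part of the invariant apart from the sign, for words of 1, …, 2+k.  With n the
-- largest letter: `first` if the word begins with n, followed by the shape of the rest;
-- `later j` if n stands elsewhere and, once n and its predecessor are deleted, the word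
-- begins with exactly the first j of the letters n-1, n-2, …, 3.  All words of length two
-- have the same shape.
data Shape : ℕ → Set where
  flat  : Shape 0
  first : ∀ {k} → Shape k → Shape (suc k)
  later : ∀ {k} → Fin (suc k) → Shape (suc k)

-- The number of letters 2+k, 1+k, …, 3 that the word begins with, in this order.
lead : ∀ k → List ℕ → Fin (suc k)
lead zero    _       = zero
lead (suc k) []      = zero
lead (suc k) (c ∷ r) with c ≟ 3 + k
... | yes _ = suc (lead k r)
... | no  _ = zero

-- cut m y q  deletes the first m that is not the initial letter, together with its
-- predecessor, from the word y ∷ q; if there is no such m, the word is unchanged.
cut : ℕ → ℕ → List ℕ → List ℕ
cut m y []      = y ∷ []
cut m y (z ∷ q) with z ≟ m
... | yes _ = q
... | no  _ = y ∷ cut m z q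

cut-found : ∀ m y q → cut m y (m ∷ q) ≡ q
cut-found m y q with m ≟ m
... | yes _ = refl
... | no  ≢ = contradiction refl ≢

-- The default value for the empty word is irrelevant.
shape : ∀ k → List ℕ → Shape k
shape zero    _       = flat
shape (suc k) []      = later zero
shape (suc k) (c ∷ w) with c ≟ 3 + k
... | yes _ = first (shape k w)
... | no  _ = later (lead k (cut (3 + k) c w))

-- The canonical word for `later j` is  stem, foot, 3+k.  After its j leading letters, the
-- stem lists the remaining letters except the largest, which is the foot; when only a and
-- b remain, b is the foot.
stem : ∀ k → Fin (suc k) → ℕ → ℕ → List ℕ
stem zero    zero    a b = a ∷ []
stem (suc k) zero    a b = descent k a b
stem (suc k) (suc j) a b = 3 + k ∷ stem k j a b

foot : ∀ k → Fin (suc k) → ℕ → ℕ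
foot zero    zero    b = b
foot (suc k) zero    b = 3 + k
foot (suc k) (suc j) b = foot k j b

-- The two canonical words of a shape are those with (a, b) = (1, 2) and (2, 1).
canon : ∀ {k} → Shape k → ℕ → ℕ → List ℕ
canon flat          a b = a ∷ b ∷ []
canon (first {k} s) a b = 3 + k ∷ canon s a b
canon (later {k} j) a b = stem k j a b ++ foot k j b ∷ 3 + k ∷ []

-- Every word is equivalent to a canonical word of its shape

-- The word r y M is equivalent to one of the two words with stem and foot given by j,
-- followed by M.
StateCanonical : ∀ k → Fin (suc k) → ℕ → List ℕ → ℕ → Set
StateCanonical k j M r y =
    r ++ y ∷ M ∷ [] ~ stem k j 1 2 ++ foot k j 2 ∷ M ∷ []
  ⊎ r ++ y ∷ M ∷ [] ~ stem k j 2 1 ++ foot k j 1 ∷ M ∷ []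

-- The case in which the largest letter 3+k precedes M.
state-top : ∀ k {r M} → r ↭ descent k 1 2 → 3 + k < M → StateCanonical (suc k) zero M r (3 + k)
state-top k r↭ k<M = Sum.map (≈-foot k<M r<) (≈-foot k<M r<) (cycle-sort k r↭)
  where r< = descent-↭⇒< k r↭

-- If 3+k stands inside r, preceded by z, then one exchange at the foot puts it before M.
state-inner : ∀ k p z q {y M} → y ∷ p ++ z ∷ q ↭ descent k 1 2 → 3 + k < M →
              StateCanonical (suc k) zero M (p ++ z ∷ 3 + k ∷ q) y
state-inner k p z q {y} {M} yr↭ k<M
  with y< ∷ r< ← descent-↭⇒< k yr↭
  with z< ∷ q< ← ++⁻ʳ p r<
  = Sum.map (e ◅◅_) (e ◅◅_) (state-top k (↭-trans (shift y p (z ∷ q)) yr↭) k<M)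
  where
  e : (p ++ z ∷ 3 + k ∷ q) ++ y ∷ M ∷ [] ~ (p ++ y ∷ z ∷ q) ++ 3 + k ∷ M ∷ []
  e = subst₂ _~_ (sym (++-assoc p _ _)) (sym (++-assoc p _ _))
        (p ++~ ~-sym (rotate-foot q y< z< k<M (All.map (λ l → <-trans l k<M) q<)))

snoc-view : ∀ (c : ℕ) p → ∃[ p′ ] ∃[ z ] c ∷ p ≡ p′ ∷ʳ z
snoc-view c []      = [] , c , refl
snoc-view c (d ∷ p) with p′ , z , e ← snoc-view d p = c ∷ p′ , z , cong (c ∷_) e

snoc-++ : ∀ {w} p′ (z : ℕ) q → w ≡ p′ ∷ʳ z → w ++ q ≡ p′ ++ z ∷ q
snoc-++ p′ z q refl = ++-assoc p′ (z ∷ []) q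

state-complete : ∀ k {r y M} → y ∷ r ↭ descent k 1 2 → 2 + k < M → StateCanonical k (lead k r) M r y
state-complete zero {r} {y} {M} yr↭ _ with pair-cases yr↭
... | inj₁ refl = inj₂ ε
... | inj₂ refl = inj₁ ε
state-complete (suc k) {[]} yr↭ _ =
  contradiction (trans (↭-length yr↭) (cong suc (descent-length k))) λ ()
state-complete (suc k) {c ∷ r} {y} {M} yr↭ k<M with c ≟ 3 + k
... | yes refl = Sum.map (c ∷~_) (c ∷~_)
                   (state-complete k (drop-∷ (↭-trans (swap c y ↭-refl) yr↭)) (<-trans (n<1+n _) k<M))
... | no c≢ with split k yr↭
... | [] , q , refl , q↭ = state-top k q↭ k<M
... | y ∷ [] , q , refl , _ = contradiction refl c≢
... | y ∷ d ∷ p , q , refl , pq↭ with p′ , z , e ← snoc-view d p =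
  subst (λ r → StateCanonical (suc k) zero M r y) (sym (snoc-++ p′ z _ e))
    (state-inner k p′ z q (↭-trans (↭-reflexive (cong (y ∷_) (sym (snoc-++ p′ z _ e)))) pq↭) k<M)

cut-block : ∀ {m y} c p q → All (_< m) p → y < m → cut m c (p ++ y ∷ m ∷ q) ≡ c ∷ p ++ q
cut-block {m} {y} c [] q [] y< with y ≟ m
... | yes e = contradiction e (<⇒≢ y<)
... | no  _ = cong (c ∷_) (cut-found m y q)
cut-block {m} c (d ∷ p) q (d< ∷ p<) y< with d ≟ m
... | yes e = contradiction e (<⇒≢ d<)
... | no  _ = cong (c ∷_) (cut-block d p q p< y<)

shape-first : ∀ k w → shape (suc k) (3 + k ∷ w) ≡ first (shape k w)
shape-first k w with 3 + k ≟ 3 + k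
... | yes _ = refl
... | no  ≢ = contradiction refl ≢

shape-later : ∀ k p {y} q → All (_< 3 + k) p → y < 3 + k →
              shape (suc k) (p ++ y ∷ 3 + k ∷ q) ≡ later (lead k (p ++ q))
shape-later k [] {y} q [] y< with y ≟ 3 + k
... | yes e = contradiction e (<⇒≢ y<)
... | no  _ = cong (later ∘ lead k) (cut-found (3 + k) y q)
shape-later k (c ∷ p) q (c< ∷ p<) y< with c ≟ 3 + k
... | yes e = contradiction e (<⇒≢ c<)
... | no  _ = cong (later ∘ lead k) (cut-block c p q p< y<)

Canonical : ∀ k → List ℕ → Set
Canonical k w = w ~ canon (shape k w) 1 2 ⊎ w ~ canon (shape k w) 2 1

-- The block y, 3+k moves to the end of the word.
later-complete : ∀ k p y q → p ++ y ∷ q ↭ descent k 1 2 → Canonical (suc k) (p ++ y ∷ 3 + k ∷ q)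
later-complete k p y q pq↭
  with pq< ← descent-↭⇒< k pq↭
  with y< ∷ q< ← ++⁻ʳ p pq<
  rewrite shape-later k p q (++⁻ˡ p pq<) y<
  = Sum.map (move ◅◅_) (move ◅◅_) (state-complete k (↭-trans (↭-sym (shift y p q)) pq↭) (n<1+n _))
  where
  move : p ++ y ∷ 3 + k ∷ q ~ (p ++ q) ++ y ∷ 3 + k ∷ []
  move = subst₂ _~_ (cong (λ t → p ++ y ∷ 3 + k ∷ t) (++-identityʳ q)) (sym (++-assoc p _ _))
           (p ++~ block-right q [] y< q<)

complete : ∀ k {w} → w ↭ descent k 1 2 → Canonical k w
complete zero w↭ = Sum.map (λ { refl → ε }) (λ { refl → ε }) (pair-cases w↭)
complete (suc k) w↭ with split k w↭
... | [] , q , refl , q↭ rewrite shape-first k q = Sum.map (_ ∷~_) (_ ∷~_) (complete k q↭)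
... | c ∷ p , q , refl , pq↭ with p′ , y , e ← snoc-view c p =
  subst (Canonical (suc k)) (sym (snoc-++ p′ y _ e))
    (later-complete k p′ y q (subst (_↭ descent k 1 2) (snoc-++ p′ y q e) pq↭))

-- Invariance of the shape

-- A rotation of x y m with largest letter m, where no earlier letter equals m and x, y are
-- different.  Rotations of words with distinct letters are of this kind.
data Step (m : ℕ) : List ℕ → List ℕ → Set where
  here  : ∀ {x y b} → x < m → y < m → x ≢ y → Step m (x ∷ y ∷ m ∷ b) (y ∷ m ∷ x ∷ b)
  there : ∀ {c w w′} → c ≢ m → Step m w w′ → Step m (c ∷ w) (c ∷ w′)

-- Words that agree up to some place, without m occurring before it, and then continue with
-- letters smaller than m.  If m ≤ 2+k, then `lead k` does not tell them apart: having not
-- met m, it waits for a letter that is at least m, so it stops there at the latest.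
data Fork (m : ℕ) : List ℕ → List ℕ → Set where
  here  : ∀ {x y r r′} → x < m → y < m → Fork m (x ∷ r) (y ∷ r′)
  there : ∀ {c r r′} → c ≢ m → Fork m r r′ → Fork m (c ∷ r) (c ∷ r′)

step⇒fork : ∀ {m w w′} → Step m w w′ → Fork m w w′
step⇒fork (here x< y< _) = here x< y<
step⇒fork (there c≢ s) = there c≢ (step⇒fork s)

below-top : ∀ {c m k} → c ≡ suc k → c ≢ m → m ≤ suc k → m ≤ k
below-top refl c≢m m≤ = ≤-pred (≤∧≢⇒< m≤ (≢-sym c≢m))

lead-fork : ∀ k {m r r′} → m ≤ 2 + k → Fork m r r′ → lead k r ≡ lead k r′
lead-fork zero    _  _ = refl
lead-fork (suc k) m≤ (here {x} {y} x< y<) with x ≟ 3 + k | y ≟ 3 + k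
... | yes refl | _ = contradiction (<-≤-trans x< m≤) (<-irrefl refl)
... | no _ | yes refl = contradiction (<-≤-trans y< m≤) (<-irrefl refl)
... | no _ | no _ = refl
lead-fork (suc k) m≤ (there {c} c≢ f) with c ≟ 3 + k
... | yes e = cong suc (lead-fork k (below-top e c≢ m≤) f)
... | no _ = refl

cut-skip : ∀ {m y z q} → z ≢ m → cut m y (z ∷ q) ≡ y ∷ cut m z q
cut-skip {m} {z = z} z≢ with z ≟ m
... | yes e = contradiction e z≢
... | no  _ = refl

-- A rotation with the largest letter m only moves the block that is deleted.
cut-top : ∀ {m c c′ w w′} → Step m (c ∷ w) (c′ ∷ w′) → cut m c w ≡ cut m c′ w′
cut-top {m} (here {x} {y} {b} x< y< _)
  rewrite cut-skip {y = x} {q = m ∷ b} (<⇒≢ y<) | cut-found m y b | cut-found m y (x ∷ b) = refl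
cut-top (there {c} _ s@(here x< y< _)) =
  trans (cut-skip (<⇒≢ x<)) (trans (cong (c ∷_) (cut-top s)) (sym (cut-skip (<⇒≢ y<))))
cut-top (there {c} _ s@(there d≢ _)) =
  trans (cut-skip d≢) (trans (cong (c ∷_) (cut-top s)) (sym (cut-skip d≢)))

-- Any other rotation leaves a fork at its window, since t is not among the letters moved.
cut-fork : ∀ {m t c c′ w w′} → m < t → Step m (c ∷ w) (c′ ∷ w′) → Fork m (cut t c w) (cut t c′ w′)
cut-fork {t = t} m<t (here x< y< _) =
  subst₂ (Fork _) (sym (cut-skip (<⇒≢ (<-trans y< m<t)))) (sym (cut-skip (<⇒≢ m<t))) (here x< y<)
cut-fork m<t (there c≢ s@(here x< y< _)) =
  subst₂ (Fork _) (sym (cut-skip (<⇒≢ (<-trans x< m<t)))) (sym (cut-skip (<⇒≢ (<-trans y< m<t))))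
    (there c≢ (cut-fork m<t s))
cut-fork {t = t} m<t (there c≢ s@(there {d} _ s′)) with d ≟ t
... | yes _ = step⇒fork s′
... | no  _ = there c≢ (cut-fork m<t s)

shape-step : ∀ k {m w w′} → m ≤ 2 + k → Step m w w′ → shape k w ≡ shape k w′
shape-step zero _ _ = refl
shape-step (suc k) {m} {[]} m≤ ()
shape-step (suc k) {m} {c ∷ w} {[]} m≤ ()
shape-step (suc k) {m} {c ∷ w} {c′ ∷ w′} m≤ s = go s
  where
  later-step : later (lead k (cut (3 + k) c w)) ≡ later (lead k (cut (3 + k) c′ w′))
  later-step = cong later ([ (λ m< → lead-fork k (≤-pred m<) (cut-fork m< s))
                           , (λ { refl → cong (lead k) (cut-top s) }) ]′ (m≤n⇒m<n∨m≡n m≤))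
  go : Step m (c ∷ w) (c′ ∷ w′) → shape (suc k) (c ∷ w) ≡ shape (suc k) (c′ ∷ w′)
  go (here {x} {y} x< y< _) with x ≟ 3 + k | y ≟ 3 + k
  ... | yes refl | _ = contradiction (<-≤-trans x< m≤) (<-irrefl refl)
  ... | no _ | yes refl = contradiction (<-≤-trans y< m≤) (<-irrefl refl)
  ... | no _ | no _ = later-step
  go (there c≢ s′) with c ≟ 3 + k
  ... | yes e = cong first (shape-step k (below-top e c≢ m≤) s′)
  ... | no _ = later-step

-- Invariance of the sign

-- The parity of the number of letters smaller than c.
below : ℕ → List ℕ → Bool
below c []      = false
below c (x ∷ w) = does (x <? c) xor below c w

-- The parity of the number of inversions.
sign : List ℕ → Bool
sign []      = false
sign (c ∷ w) = below c w xor sign w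

-- Transposition of two adjacent, different letters.
data Swap : List ℕ → List ℕ → Set where
  here  : ∀ {a b q} → a ≢ b → Swap (a ∷ b ∷ q) (b ∷ a ∷ q)
  there : ∀ {c w w′} → Swap w w′ → Swap (c ∷ w) (c ∷ w′)

Swap⇒↭ : ∀ {w w′} → Swap w w′ → w ↭ w′
Swap⇒↭ (here _)  = swap _ _ ↭-refl
Swap⇒↭ (there s) = prep _ (Swap⇒↭ s)

xor-exchange : ∀ p q r → p xor (q xor r) ≡ q xor (p xor r)
xor-exchange true  true  r = refl
xor-exchange true  false r = refl
xor-exchange false true  r = refl
xor-exchange false false r = refl

below-swap : ∀ {w w′} c → Swap w w′ → below c w ≡ below c w′
below-swap c (here {a} {b} _) = xor-exchange (does (a <? c)) (does (b <? c)) _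
below-swap c (there {x} s) = cong (does (x <? c) xor_) (below-swap c s)

<?-flip : ∀ {a b} → a ≢ b → does (b <? a) ≡ not (does (a <? b))
<?-flip {a} {b} a≢b with <-cmp a b
... | tri< a<b _ b≮a = trans (dec-false (b <? a) b≮a) (cong not (sym (dec-true (a <? b) a<b)))
... | tri≈ _ a≡b _ = contradiction a≡b a≢b
... | tri> a≮b _ b<a = trans (dec-true (b <? a) b<a) (cong not (sym (dec-false (a <? b) a≮b)))

sign-swap : ∀ {w w′} → Swap w w′ → sign w ≡ not (sign w′)
sign-swap (here {a} {b} {q} a≢b) = begin
  (does (b <? a) xor below a q) xor (below b q xor sign q)
    ≡⟨ cong (λ l → (l xor below a q) xor (below b q xor sign q)) (<?-flip a≢b) ⟩
  (not l xor below a q) xor (below b q xor sign q)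
    ≡⟨ cong (_xor (below b q xor sign q)) (sym (not-distribˡ-xor l (below a q))) ⟩
  not (l xor below a q) xor (below b q xor sign q)
    ≡⟨ sym (not-distribˡ-xor (l xor below a q) _) ⟩
  not ((l xor below a q) xor (below b q xor sign q))
    ≡⟨ cong not (xor-interchange l (below a q) (below b q) (sign q)) ⟩
  not ((l xor below b q) xor (below a q xor sign q)) ∎
  where
  open ≡-Reasoning
  l = does (a <? b)
  xor-interchange : ∀ p q r s → (p xor q) xor (r xor s) ≡ (p xor r) xor (q xor s)
  xor-interchange p q r s = trans (xor-assoc p q _)
    (trans (cong (p xor_) (xor-exchange q r s)) (sym (xor-assoc p r _)))
sign-swap (there {c} {w} {w′} s) =
  trans (cong₂ _xor_ (below-swap c s) (sign-swap s)) (sym (not-distribʳ-xor (below c w′) (sign w′)))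

-- x y m → y x m → y m x
step-swaps : ∀ {m w w′} → Step m w w′ → ∃[ v ] Swap w v × Swap v w′
step-swaps (here x< _ x≢y) = _ , here x≢y , there (here (<⇒≢ x<))
step-swaps (there _ s) with v , s₁ , s₂ ← step-swaps s = _ , there s₁ , there s₂

sign-step : ∀ {m w w′} → Step m w w′ → sign w ≡ sign w′
sign-step s with v , s₁ , s₂ ← step-swaps s =
  trans (sign-swap s₁) (trans (cong not (sign-swap s₂)) (not-involutive _))

-- Properties of the canonical words

descent-swap : ∀ k {a b} → a ≢ b → ∀ q → Swap (descent k a b ++ q) (descent k b a ++ q)
descent-swap zero    a≢b q = here a≢b
descent-swap (suc k) a≢b q = there (descent-swap k a≢b q)

canon-swap : ∀ {k} (s : Shape k) {a b} → a ≢ b → Swap (canon s a b) (canon s b a)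
canon-swap flat      a≢b = here a≢b
canon-swap (first s) a≢b = there (canon-swap s a≢b)
canon-swap (later {k} j) {a} {b} a≢b = go k j
  where
  go : ∀ k (j : Fin (suc k)) {q} → Swap (stem k j a b ++ foot k j b ∷ q) (stem k j b a ++ foot k j a ∷ q)
  go zero    zero    = here a≢b
  go (suc k) zero    = descent-swap k a≢b _
  go (suc k) (suc j) = there (go k j)

descent-↭ : ∀ k → descent k 2 1 ↭ descent k 1 2
descent-↭ zero    = swap 2 1 ↭-refl
descent-↭ (suc k) = prep (3 + k) (descent-↭ k)

stem-↭ : ∀ k j {a b} → stem k j a b ∷ʳ foot k j b ↭ descent k a b
stem-↭ zero    zero    = ↭-refl
stem-↭ (suc k) zero    = ↭-sym (∷↭∷ʳ (3 + k) (descent k _ _))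
stem-↭ (suc k) (suc j) = prep (3 + k) (stem-↭ k j)

canon-↭ : ∀ {k} (s : Shape k) {a b} → canon s a b ↭ descent k a b
canon-↭ flat          = ↭-refl
canon-↭ (first {k} s) = prep (3 + k) (canon-↭ s)
canon-↭ (later {k} j) =
  ↭-trans (↭-reflexive (sym (++-assoc (stem k j _ _) _ _)))
    (↭-trans (↭-sym (∷↭∷ʳ (3 + k) _)) (prep (3 + k) (stem-↭ k j)))

lead-skip : ∀ {k c r} → c < 3 + k → lead (suc k) (c ∷ r) ≡ zero
lead-skip {k} {c} c< with c ≟ 3 + k
... | yes e = contradiction e (<⇒≢ c<)
... | no  _ = refl

lead-stem : ∀ k j {a b} → a ≤ 2 → lead k (stem k j a b) ≡ j
lead-stem zero          zero    _   = refl
lead-stem (suc zero)    zero    a≤2 = lead-skip (s≤s a≤2)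
lead-stem (suc (suc k)) zero    _   = lead-skip ≤-refl
lead-stem (suc k)       (suc j) a≤2 with 3 + k ≟ 3 + k
... | yes _ = cong suc (lead-stem k j a≤2)
... | no  ≢ = contradiction refl ≢

shape-canon : ∀ {k} (s : Shape k) {a b} → a ≤ 2 → b ≤ 2 → shape k (canon s a b) ≡ s
shape-canon flat          _   _   = refl
shape-canon (first {k} s) a≤2 b≤2 = trans (shape-first k _) (cong first (shape-canon s a≤2 b≤2))
shape-canon (later {k} j) a≤2 b≤2 =
  trans (shape-later k (stem k j _ _) [] (++⁻ˡ (stem k j _ _) stem<) (All.head (++⁻ʳ (stem k j _ _) stem<)))
    (cong later (trans (cong (lead k) (++-identityʳ _)) (lead-stem k j a≤2)))
  where stem< = All-resp-↭ (↭-sym (stem-↭ k j)) (All.map s≤s (descent-≤ k a≤2 b≤2))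

-- Words of permutations

word : ∀ {n} → Permutation′ n → List ℕ
word φ = toList (oneLine φ)

toList-tabulate : ∀ {n} (f : Fin n → ℕ) → toList (Vec.tabulate f) ≡ List.tabulate f
toList-tabulate {zero}  f = refl
toList-tabulate {suc n} f = cong (f zero ∷_) (toList-tabulate (f ∘ suc))

word-tabulate : ∀ {n} (φ : Permutation′ n) → word φ ≡ List.tabulate (suc ∘ toℕ ∘ (φ ⟨$⟩ʳ_))
word-tabulate φ = toList-tabulate _

permute-injective : ∀ {n} (π : Permutation′ n) {i j} → π ⟨$⟩ʳ i ≡ π ⟨$⟩ʳ j → i ≡ j
permute-injective π = Injection.injective (↔⇒↣ π)

tabulate-permute : ∀ {n} (f : Fin n → ℕ) (π : Permutation′ n) →
                   List.tabulate (f ∘ (π ⟨$⟩ʳ_)) ↭ List.tabulate f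
tabulate-permute {n} f π = subst₂ _↭_ (Listₚ.map-tabulate _ f) (Listₚ.map-tabulate _ f)
  (map⁺ f (∼bag⇒↭ (unique∧set⇒bag (Unique.tabulate⁺ (permute-injective π)) (Unique.tabulate⁺ λ e → e)
    (λ {i} → mk⇔ (λ _ → ∈-tabulate⁺ i)
                 (λ _ → subst (_∈ List.tabulate (π ⟨$⟩ʳ_)) (inverseʳ π) (∈-tabulate⁺ (π ⟨$⟩ˡ i)))))))

tabulate-∷ʳ : ∀ n (g : ℕ → ℕ) → List.tabulate {n = suc n} (g ∘ toℕ) ≡ List.tabulate {n = n} (g ∘ toℕ) ∷ʳ g n
tabulate-∷ʳ zero    g = refl
tabulate-∷ʳ (suc n) g = cong (g 0 ∷_) (tabulate-∷ʳ n (g ∘ suc))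

descent-tabulate : ∀ k → descent k 1 2 ↭ List.tabulate {n = 2 + k} (suc ∘ toℕ)
descent-tabulate zero    = ↭-refl
descent-tabulate (suc k) = ↭-trans (∷↭∷ʳ (3 + k) (descent k 1 2))
  (subst (descent k 1 2 ∷ʳ (3 + k) ↭_) (sym (tabulate-∷ʳ (2 + k) suc))
    (++⁺ʳ _ (descent-tabulate k)))

word-↭ : ∀ {k} (φ : Permutation′ (2 + k)) → word φ ↭ descent k 1 2
word-↭ {k} φ = ↭-trans (↭-reflexive (word-tabulate φ))
  (↭-trans (tabulate-permute (suc ∘ toℕ) φ) (↭-sym (descent-tabulate k)))

word-unique : ∀ {n} (φ : Permutation′ n) → Unique (word φ)
word-unique φ = subst Unique (sym (word-tabulate φ))
  (Unique.tabulate⁺ (permute-injective φ ∘ Finₚ.toℕ-injective ∘ suc-injective))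

cast-tabulate : ∀ {n} (w : List ℕ) (eq : n ≡ length w) →
                List.tabulate (List.lookup w ∘ cast eq) ≡ w
cast-tabulate w refl =
  trans (Listₚ.tabulate-cong (cong (List.lookup w) ∘ Finₚ.cast-is-id refl)) (Listₚ.tabulate-lookup w)

realise-tabulate : ∀ {n} (f : Fin n → ℕ) {w} → w ↭ List.tabulate f →
                   ∃[ π ] List.tabulate (f ∘ (_⟨$⟩ʳ_ {n} {n} π)) ≡ w
realise-tabulate {n} f {w} w↭ = π , trans (Listₚ.tabulate-cong (sym ∘ letter)) (cast-tabulate w eq)
  where
  ρ = ↭⇒↭ₛ w↭
  eq : n ≡ length w
  eq = sym (trans (↭-length w↭) (Listₚ.length-tabulate f))
  π : Permutation′ n
  π = cast-id eq ∘ₚ onIndices ρ ∘ₚ cast-id (Listₚ.length-tabulate f)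
  lookup-cast : ∀ j → List.lookup (List.tabulate f) j ≡ f (cast (Listₚ.length-tabulate f) j)
  lookup-cast j = trans
    (cong (List.lookup (List.tabulate f)) (sym (Finₚ.cast-involutive _ (Listₚ.length-tabulate f) j)))
    (Listₚ.lookup-tabulate f _)
  letter : ∀ i → List.lookup w (cast eq i) ≡ f (π ⟨$⟩ʳ i)
  letter i = trans (onIndices-lookup ρ (cast eq i)) (lookup-cast _)

-- Every rearrangement of 1, …, 2+k is the word of a permutation.
realise : ∀ {k w} → w ↭ descent k 1 2 → ∃[ φ ] word {2 + k} φ ≡ w
realise {k} w↭ with φ , e ← realise-tabulate (suc ∘ toℕ) (↭-trans w↭ (descent-tabulate k)) =
  φ , trans (word-tabulate φ) e

-- Replacements are rotations

module _ {c} (u : Vec ℕ c) (σ : Permutation′ c) where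
  -- The letters of u listed in the order prescribed by σ: `ranked i` is the letter whose
  -- rank according to σ is i.  If σ is the order permutation of u, they increase.
  ranked : Fin c → ℕ
  ranked i = lookup u (σ ⟨$⟩ˡ i)

  ranked-mono : IsOrderPermutation u σ → ∀ {i j} → i <ᶠ j → ranked i < ranked j
  ranked-mono ord i<j = Equivalence.to (ord _ _) (subst₂ _<ᶠ_ (sym (inverseʳ σ)) (sym (inverseʳ σ)) i<j)

  mono⇒order : (∀ {i j} → i <ᶠ j → ranked i < ranked j) → IsOrderPermutation u σ
  mono⇒order mono i j = mk⇔ to from
    where
    lookup-ranked : ∀ i → ranked (σ ⟨$⟩ʳ i) ≡ lookup u i
    lookup-ranked i = cong (lookup u) (inverseˡ σ)
    to : ∀ {i j} → σ ⟨$⟩ʳ i <ᶠ σ ⟨$⟩ʳ j → lookup u i < lookup u j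
    to l = subst₂ _<_ (lookup-ranked _) (lookup-ranked _) (mono l)
    from : lookup u i < lookup u j → σ ⟨$⟩ʳ i <ᶠ σ ⟨$⟩ʳ j
    from l with Finₚ.<-cmp (σ ⟨$⟩ʳ i) (σ ⟨$⟩ʳ j)
    ... | tri< σ< _ _ = σ<
    ... | tri≈ _ σ≡ _ = contradiction l (<-irrefl (cong (lookup u) (permute-injective σ σ≡)))
    ... | tri> _ _ σ> = contradiction l (<-asym (to σ>))

tabulate-injective : ∀ {n} {f g : Fin n → ℕ} → List.tabulate f ≡ List.tabulate g → ∀ i → f i ≡ g i
tabulate-injective e zero    = Listₚ.∷-injectiveˡ e
tabulate-injective e (suc i) = tabulate-injective (Listₚ.∷-injectiveʳ e) i

ranked-unique : ∀ {c} (u v : Vec ℕ c) σ τ → IsOrderPermutation u σ → IsOrderPermutation v τ →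
                toList u ↭ toList v → ∀ i → ranked u σ i ≡ ranked v τ i
ranked-unique u v σ τ ou ov u↭v = tabulate-injective (≋⇒≡
  (↗↭↗⇒≋ ≤-totalOrder (sorted u σ ou) (sorted v τ ov)
    (↭⇒↭ₛ (↭-trans (ranked-↭ u σ) (↭-trans u↭v (↭-sym (ranked-↭ v τ)))))))
  where
  sorted : ∀ {c} (u : Vec ℕ c) σ → IsOrderPermutation u σ → _
  sorted u σ ou = AllPairs⇒Linked (AllPairs.tabulate⁺-< (<⇒≤ ∘ ranked-mono u σ ou))
  ranked-↭ : ∀ {c} (u : Vec ℕ c) σ → List.tabulate (ranked u σ) ↭ toList u
  ranked-↭ u σ = ↭-trans (tabulate-permute (lookup u) (flip σ))
    (↭-reflexive (trans (sym (toList-tabulate (lookup u))) (cong toList (Vecₚ.tabulate∘lookup u))))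

-- The letters of equal rank in two words with the same set of letters are equal.
same-rank : ∀ {c} (u v : Vec ℕ c) σ τ → IsOrderPermutation u σ → IsOrderPermutation v τ →
            toList u ↭ toList v → ∀ {i j} → σ ⟨$⟩ʳ i ≡ τ ⟨$⟩ʳ j → lookup u i ≡ lookup v j
same-rank u v σ τ ou ov u↭v {i} {j} e = begin
  lookup u i                 ≡⟨ cong (lookup u) (inverseˡ σ) ⟨
  ranked u σ (σ ⟨$⟩ʳ i)       ≡⟨ ranked-unique u v σ τ ou ov u↭v _ ⟩
  ranked v τ (σ ⟨$⟩ʳ i)       ≡⟨ cong (ranked v τ) e ⟩
  ranked v τ (τ ⟨$⟩ʳ j)       ≡⟨ cong (lookup v) (inverseˡ τ) ⟩
  lookup v j                 ∎
  where open ≡-Reasoning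

drop-prefix : ∀ p {w w′ : List ℕ} → p ++ w ↭ p ++ w′ → w ↭ w′
drop-prefix []      w↭ = w↭
drop-prefix (c ∷ p) w↭ = drop-prefix p (drop-∷ w↭)

drop-context : ∀ p q {w w′ : List ℕ} → p ++ w ++ q ↭ p ++ w′ ++ q → w ↭ w′
drop-context p q {w} {w′} w↭ =
  drop-prefix q (↭-trans (++-comm q w) (↭-trans (drop-prefix p w↭) (++-comm w′ q)))

rot-context : ∀ p {w w′} → Rot w w′ → Rot (p ++ w) (p ++ w′)
rot-context []      r = r
rot-context (c ∷ p) r = there (rot-context p r)

oneLine-lookup : ∀ {c} (σ : Permutation′ c) {s} → oneLine σ ≡ s → ∀ i → suc (toℕ (σ ⟨$⟩ʳ i)) ≡ lookup s i
oneLine-lookup σ refl i = sym (Vecₚ.lookup∘tabulate _ i)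

oneLine-same : ∀ {c} (σ τ : Permutation′ c) {s t} → oneLine σ ≡ s → oneLine τ ≡ t →
               ∀ i j → lookup s i ≡ lookup t j → σ ⟨$⟩ʳ i ≡ τ ⟨$⟩ʳ j
oneLine-same σ τ eσ eτ i j e = Finₚ.toℕ-injective (suc-injective
  (trans (oneLine-lookup σ eσ i) (trans e (sym (oneLine-lookup τ eτ j)))))

order-lookup : ∀ {c} (u : Vec ℕ c) σ {s} → IsOrderPermutation u σ → oneLine σ ≡ s →
               ∀ i j → lookup s i < lookup s j → lookup u i < lookup u j
order-lookup u σ ou eσ i j l = Equivalence.to (ou i j)
  (≤-pred (subst₂ _<_ (sym (oneLine-lookup σ eσ i)) (sym (oneLine-lookup σ eσ j)) l))

-- Both parts of K consist of order permutations x y z and y z x with z the largest.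
order⇒rot : ∀ (u v : Vec ℕ 3) σ τ b {x y z} → x < z → y < z →
            oneLine σ ≡ x ∷ y ∷ z ∷ [] → oneLine τ ≡ y ∷ z ∷ x ∷ [] →
            IsOrderPermutation u σ → IsOrderPermutation v τ → toList u ↭ toList v →
            Rot (toList u ++ b) (toList v ++ b)
order⇒rot u v σ τ b {x} {y} {z} x<z y<z eσ eτ ou ov u↭v =
  rotated u v (order-lookup u σ ou eσ 0F 2F x<z) (order-lookup u σ ou eσ 1F 2F y<z)
    (agree 1F 0F refl) (agree 2F 1F refl) (agree 0F 2F refl)
  where
  agree : ∀ i j → lookup (x ∷ y ∷ z ∷ []) i ≡ lookup (y ∷ z ∷ x ∷ []) j → lookup u i ≡ lookup v j
  agree i j e = same-rank u v σ τ ou ov u↭v (oneLine-same σ τ eσ eτ i j e)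
  rotated : ∀ (u v : Vec ℕ 3) → lookup u 0F < lookup u 2F → lookup u 1F < lookup u 2F →
            lookup u 1F ≡ lookup v 0F → lookup u 2F ≡ lookup v 1F → lookup u 0F ≡ lookup v 2F →
            Rot (toList u ++ b) (toList v ++ b)
  rotated (_ ∷ _ ∷ _ ∷ []) (_ ∷ _ ∷ _ ∷ []) u₀<u₂ u₁<u₂ refl refl refl = here u₀<u₂ u₁<u₂

same-order : ∀ {c} (u v : Vec ℕ c) σ τ → oneLine σ ≡ oneLine τ →
             IsOrderPermutation u σ → IsOrderPermutation v τ → toList u ↭ toList v → u ≡ v
same-order u v σ τ e ou ov u↭v =
  trans (sym (Vecₚ.tabulate∘lookup u)) (trans (Vecₚ.tabulate-cong
    (λ i → same-rank u v σ τ ou ov u↭v (oneLine-same σ τ e refl i i refl))) (Vecₚ.tabulate∘lookup v))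

replace-words : ∀ {k} (φ ψ : Permutation′ (2 + k)) → Replace K φ ψ →
                word φ ≡ word ψ ⊎ SymClosure Rot (word φ) (word ψ)
replace-words {k} φ ψ (a , b , u , v , σ , τ , eφ , eψ , ou , ov , same) = go same
  where
  words-↭ : word φ ↭ word ψ
  words-↭ = ↭-trans (word-↭ φ) (↭-sym (word-↭ ψ))
  u↭v : toList u ↭ toList v
  u↭v = drop-context a b (subst₂ _↭_ eφ eψ words-↭)
  equal : oneLine σ ≡ oneLine τ → word φ ≡ word ψ ⊎ SymClosure Rot (word φ) (word ψ)
  equal e = inj₁ (trans eφ (trans (cong (λ u → a ++ toList u ++ b) (same-order u v σ τ e ou ov u↭v)) (sym eψ)))
  forward : ∀ {x y z} → x < z → y < z → oneLine σ ≡ x ∷ y ∷ z ∷ [] → oneLine τ ≡ y ∷ z ∷ x ∷ [] →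
            word φ ≡ word ψ ⊎ SymClosure Rot (word φ) (word ψ)
  forward x<z y<z eσ eτ = inj₂ (fwd (subst₂ Rot (sym eφ) (sym eψ)
    (rot-context a (order⇒rot u v σ τ b x<z y<z eσ eτ ou ov u↭v))))
  backward : ∀ {x y z} → x < z → y < z → oneLine τ ≡ x ∷ y ∷ z ∷ [] → oneLine σ ≡ y ∷ z ∷ x ∷ [] →
             word φ ≡ word ψ ⊎ SymClosure Rot (word φ) (word ψ)
  backward x<z y<z eτ eσ = inj₂ (bwd (subst₂ Rot (sym eψ) (sym eφ)
    (rot-context a (order⇒rot v u τ σ b x<z y<z eτ eσ ov ou (↭-sym u↭v)))))
  1<3 : 1 < 3
  1<3 = s≤s (s≤s z≤n)
  2<3 : 2 < 3
  2<3 = ≤-refl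
  go : SamePart K σ τ → word φ ≡ word ψ ⊎ SymClosure Rot (word φ) (word ψ)
  go (inj₁ e) = equal e
  go (inj₂ (here (here eσ , here eτ))) = equal (trans eσ (sym eτ))
  go (inj₂ (here (here eσ , there (here eτ)))) = forward 1<3 2<3 eσ eτ
  go (inj₂ (here (there (here eσ) , here eτ))) = backward 1<3 2<3 eτ eσ
  go (inj₂ (here (there (here eσ) , there (here eτ)))) = equal (trans eσ (sym eτ))
  go (inj₂ (there (here (here eσ , here eτ)))) = equal (trans eσ (sym eτ))
  go (inj₂ (there (here (here eσ , there (here eτ))))) = forward 2<3 1<3 eσ eτ
  go (inj₂ (there (here (there (here eσ) , here eτ)))) = backward 2<3 1<3 eτ eσ
  go (inj₂ (there (here (there (here eσ) , there (here eτ))))) = equal (trans eσ (sym eτ))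

-- Rotations are replacements

-- The permutation 231.
rotation : Permutation′ 3
rotation = permutation (λ { 0F → 1F ; 1F → 2F ; 2F → 0F }) (λ { 0F → 2F ; 1F → 0F ; 2F → 1F })
  (λ { 0F → refl ; 1F → refl ; 2F → refl }) (λ { 0F → refl ; 1F → refl ; 2F → refl })

order₃ : ∀ (u : Vec ℕ 3) (σ : Permutation′ 3) → ranked u σ 0F < ranked u σ 1F →
         ranked u σ 1F < ranked u σ 2F → IsOrderPermutation u σ
order₃ u σ 0<1 1<2 = mono⇒order u σ mono
  where
  mono : ∀ {i j} → i <ᶠ j → ranked u σ i < ranked u σ j
  mono {0F} {1F} _ = 0<1
  mono {0F} {2F} _ = <-trans 0<1 1<2
  mono {1F} {2F} _ = 1<2
  mono {1F} {1F} (s≤s ())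
  mono {2F} {1F} (s≤s ())
  mono {2F} {2F} (s≤s (s≤s ()))

order-exists : ∀ x y z → x ≢ y → x ≢ z → y ≢ z → ∃[ σ ] IsOrderPermutation (x ∷ y ∷ z ∷ []) σ
order-exists x y z x≢y x≢z y≢z with <-cmp x y | <-cmp x z | <-cmp y z
... | tri≈ _ x≡y _ | _ | _ = contradiction x≡y x≢y
... | _ | tri≈ _ x≡z _ | _ = contradiction x≡z x≢z
... | _ | _ | tri≈ _ y≡z _ = contradiction y≡z y≢z
... | tri< x<y _ _ | _            | tri< y<z _ _ = Perm.id ,
  order₃ (x ∷ y ∷ z ∷ []) Perm.id x<y y<z
... | tri< x<y _ _ | tri< x<z _ _ | tri> _ _ z<y = transpose 1F 2F ,
  order₃ (x ∷ y ∷ z ∷ []) (transpose 1F 2F) x<z z<y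
... | tri< x<y _ _ | tri> _ _ z<x | tri> _ _ z<y = rotation ,
  order₃ (x ∷ y ∷ z ∷ []) rotation z<x x<y
... | tri> _ _ y<x | tri< x<z _ _ | tri< y<z _ _ = transpose 0F 1F ,
  order₃ (x ∷ y ∷ z ∷ []) (transpose 0F 1F) y<x x<z
... | tri> _ _ y<x | tri> _ _ z<x | tri< y<z _ _ = flip rotation ,
  order₃ (x ∷ y ∷ z ∷ []) (flip rotation) y<z z<x
... | tri> _ _ y<x | _            | tri> _ _ z<y = reverse ,
  order₃ (x ∷ y ∷ z ∷ []) reverse z<y y<x

-- Equality of permutations is only pointwise, so relating two presentations of the
-- same permutation takes a trivial replacement, here of the first three letters.
replace-refl : ∀ {k} (φ ψ : Permutation′ (3 + k)) → word φ ≡ word ψ → Replace K φ ψ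
replace-refl φ ψ e with word-unique φ
... | (x≢y ∷ x≢z ∷ _) ∷ (y≢z ∷ _) ∷ _ with σ , ord ← order-exists _ _ _ x≢y x≢z y≢z =
  [] , toList (Vec.drop 3 (oneLine φ)) , Vec.take 3 (oneLine φ) , Vec.take 3 (oneLine φ) ,
  σ , σ , refl , sym e , ord , ord , inj₁ refl

-- A rotation of x y m is an instance of 123 → 231 if x < y, and of 213 → 132 if y < x.
rot-replace : ∀ {n} (φ ψ : Permutation′ n) → Rot (word φ) (word ψ) → Replace K φ ψ
rot-replace φ ψ r = go [] refl refl (word-unique φ) r
  where
  go : ∀ p {w w′} → word φ ≡ p ++ w → word ψ ≡ p ++ w′ → Unique w → Rot w w′ → Replace K φ ψ
  go p eφ eψ ((x≢y ∷ _) ∷ _) (here {x} {y} {m} {b} x<m y<m) with <-cmp x y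
  ... | tri< x<y _ _ =
    p , b , x ∷ y ∷ m ∷ [] , y ∷ m ∷ x ∷ [] , Perm.id , rotation , eφ , eψ ,
    order₃ (x ∷ y ∷ m ∷ []) Perm.id x<y y<m , order₃ (y ∷ m ∷ x ∷ []) rotation x<y y<m ,
    inj₂ (here (here refl , there (here refl)))
  ... | tri≈ _ x≡y _ = contradiction x≡y x≢y
  ... | tri> _ _ y<x =
    p , b , x ∷ y ∷ m ∷ [] , y ∷ m ∷ x ∷ [] , transpose 0F 1F , transpose 1F 2F , eφ , eψ ,
    order₃ (x ∷ y ∷ m ∷ []) (transpose 0F 1F) y<x x<m , order₃ (y ∷ m ∷ x ∷ []) (transpose 1F 2F) y<x x<m ,
    inj₂ (there (here (here refl , there (here refl))))
  go p eφ eψ (_ ∷ uniq) (there {c} {w} {w′} r) =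
    go (p ∷ʳ c) (trans eφ (sym (++-assoc p _ w))) (trans eψ (sym (++-assoc p _ w′))) uniq r

-- The intermediate words of a chain of rotations are words of permutations.
lift : ∀ {k} (φ ψ : Permutation′ (3 + k)) {w w′} →
       word φ ≡ w → w ~ w′ → w′ ≡ word ψ → EqClosure (Replace K) φ ψ
lift φ ψ eφ ε eψ = Eq.return (replace-refl φ ψ (trans eφ eψ))
lift φ ψ refl (fwd r ◅ rs) eψ with χ , eχ ← realise (↭-trans (↭-sym (Rot⇒↭ r)) (word-↭ φ)) =
  fwd (rot-replace φ χ (subst (Rot _) (sym eχ) r)) ◅ lift χ ψ eχ rs eψ
lift φ ψ refl (bwd r ◅ rs) eψ with χ , eχ ← realise (↭-trans (Rot⇒↭ r) (word-↭ φ)) =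
  bwd (rot-replace χ φ (subst (λ w → Rot w _) (sym eχ) r)) ◅ lift χ ψ eχ rs eψ

-- Classification of permutations

rot⇒step : ∀ {w w′} → Unique w → Rot w w′ → ∃[ m ] m ∈ w × Step m w w′
rot⇒step ((x≢y ∷ _) ∷ _) (here {m = m} x<m y<m) = m , there (there (here refl)) , here x<m y<m x≢y
rot⇒step (c≢ ∷ uniq) (there r) with m , m∈ , s ← rot⇒step uniq r =
  m , there m∈ , there (All.lookup c≢ m∈) s

-- The complete invariant: shape and sign.
Class : ℕ → Set
Class k = Shape k × Bool

classify : ∀ k → List ℕ → Class k
classify k w = shape k w , sign w

class : ∀ {k} → Permutation′ (2 + k) → Class k
class {k} φ = classify k (word φ)

class-rot : ∀ {k} (φ ψ : Permutation′ (2 + k)) → Rot (word φ) (word ψ) → class φ ≡ class ψ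
class-rot {k} φ ψ r with m , m∈ , s ← rot⇒step (word-unique φ) r =
  cong₂ _,_ (shape-step k (≤-pred (All.lookup (descent-↭⇒< k (word-↭ φ)) m∈)) s) (sign-step s)

class-replace : ∀ {k} (φ ψ : Permutation′ (2 + k)) → Replace K φ ψ → class φ ≡ class ψ
class-replace φ ψ r with replace-words φ ψ r
... | inj₁ e       = cong (classify _) e
... | inj₂ (fwd r) = class-rot φ ψ r
... | inj₂ (bwd r) = sym (class-rot ψ φ r)

class-cong : ∀ {k} (φ ψ : Permutation′ (2 + k)) → EqClosure (Replace K) φ ψ → class φ ≡ class ψ
class-cong _ _ = Eq.gfold isEquivalence class (λ {φ} {ψ} → class-replace φ ψ)

canonical-word : ∀ {k} → Shape k → Bool → List ℕ
canonical-word s false = canon s 1 2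
canonical-word s true  = canon s 2 1

canonical-sign : ∀ {k} (s : Shape k) b → sign (canonical-word s b) ≡ sign (canon s 1 2) xor b
canonical-sign s false = sym (xor-identityʳ _)
canonical-sign s true  = trans (sign-swap (canon-swap s (λ ()))) (sym (xor-comm (sign (canon s 1 2)) true))

canonical-↭ : ∀ {k} (s : Shape k) b → canonical-word s b ↭ descent k 1 2
canonical-↭     s false = canon-↭ s
canonical-↭ {k} s true  = ↭-trans (canon-↭ s) (descent-↭ k)

canonical-shape : ∀ {k} (s : Shape k) b → shape k (canonical-word s b) ≡ s
canonical-shape s false = shape-canon s (s≤s z≤n) ≤-refl
canonical-shape s true  = shape-canon s ≤-refl (s≤s z≤n)

xor-cancel : ∀ p q → p xor (p xor q) ≡ q
xor-cancel p q = trans (sym (xor-assoc p p q)) (cong (_xor q) (xor-same p))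

-- The canonical word of given shape and sign.
standard : ∀ {k} → Class k → List ℕ
standard (s , b) = canonical-word s (sign (canon s 1 2) xor b)

standard-↭ : ∀ {k} (c : Class k) → standard c ↭ descent k 1 2
standard-↭ (s , b) = canonical-↭ s (sign (canon s 1 2) xor b)

classify-standard : ∀ {k} (c : Class k) → classify k (standard c) ≡ c
classify-standard (s , b) =
  cong₂ _,_ (canonical-shape s (σ xor b)) (trans (canonical-sign s (σ xor b)) (xor-cancel σ b))
  where σ = sign (canon s 1 2)

-- By `complete`, a word is equivalent to one of the two canonical words of its shape;
-- by invariance of the sign, this is the one with the sign of the word.
standard-complete : ∀ {k} (φ : Permutation′ (3 + k)) → word φ ~ standard (class φ)
standard-complete {k} φ = [ via false , via true ]′ (complete (suc k) (word-↭ φ))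
  where
  s = shape (suc k) (word φ)
  via : ∀ b → word φ ~ canonical-word s b → word φ ~ standard (class φ)
  via b r with χ , eχ ← realise (canonical-↭ s b) = subst (λ b → word φ ~ canonical-word s b) b≡ r
    where
    sign≡ : sign (word φ) ≡ sign (canon s 1 2) xor b
    sign≡ = trans (cong proj₂ (class-cong φ χ (lift φ χ refl r (sym eχ))))
                  (trans (cong sign eχ) (canonical-sign s b))
    b≡ : b ≡ sign (canon s 1 2) xor sign (word φ)
    b≡ = sym (trans (cong (sign (canon s 1 2) xor_) sign≡) (xor-cancel (sign (canon s 1 2)) b))

-- Counting

-- The number of shapes of words of length 2+k.
size : ℕ → ℕ
size zero    = 1
size (suc k) = size k + suc k

shape↔Fin : ∀ k → Shape k ↔ Fin (size k)
shape↔Fin zero = mk↔ₛ′ (λ _ → zero) (λ _ → flat) (λ { zero → refl }) (λ { flat → refl })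
shape↔Fin (suc k) = ↔-trans decompose (↔-trans (shape↔Fin k ⊎-↔ ↔-refl) (↔-sym Finₚ.+↔⊎))
  where
  decompose : Shape (suc k) ↔ (Shape k ⊎ Fin (suc k))
  decompose = mk↔ₛ′ (λ { (first s) → inj₁ s ; (later j) → inj₂ j }) [ first , later ]′
    (λ { (inj₁ _) → refl ; (inj₂ _) → refl }) (λ { (first _) → refl ; (later _) → refl })

class↔Fin : ∀ k → Class k ↔ Fin (size k * 2)
class↔Fin k = ↔-trans (shape↔Fin k ×-↔ ↔-sym Finₚ.2↔Bool) (↔-sym Finₚ.*↔×)

size-formula : ∀ k → size k * 2 ≡ k * suc k + 2
size-formula zero    = refl
size-formula (suc k) = trans (*-distribʳ-+ 2 (size k) (suc k))
  (trans (cong (_+ suc k * 2) (size-formula k)) (identity k))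
  where
  identity : ∀ k → k * suc k + 2 + suc k * 2 ≡ suc k * suc (suc k) + 2
  identity = solve-∀

class-count : ∀ k → size (suc k) * 2 ≡ (3 + k) ^ 2 ∸ 3 * (3 + k) + 4
class-count k = begin
  size (suc k) * 2                                 ≡⟨ size-formula (suc k) ⟩
  suc k * (2 + k) + 2                              ≡⟨ identity₁ k ⟩
  k * (3 + k) + 4                                  ≡⟨ cong (_+ 4) (m+n∸n≡m (k * (3 + k)) (3 * (3 + k))) ⟨
  k * (3 + k) + 3 * (3 + k) ∸ 3 * (3 + k) + 4      ≡⟨ cong (λ m → m ∸ 3 * (3 + k) + 4) (identity₂ k) ⟩
  (3 + k) ^ 2 ∸ 3 * (3 + k) + 4                    ∎
  where
  open ≡-Reasoning
  identity₁ : ∀ k → suc k * (2 + k) + 2 ≡ k * (3 + k) + 4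
  identity₁ = solve-∀
  identity₂ : ∀ k → k * (3 + k) + 3 * (3 + k) ≡ (3 + k) * ((3 + k) * 1)
  identity₂ = solve-∀

proposition3p24 : ∀ (n : ℕ) → n ≥ 3 →
    HasClassCount (KEquivalence K n) (n ^ 2 ∸ 3 * n + 4)
proposition3p24 (suc (suc (suc k))) (s≤s (s≤s (s≤s z≤n))) =
  subst (HasClassCount (KEquivalence K (3 + k))) (class-count k) count
  where
  code : Class (suc k) ↔ Fin (size (suc k) * 2)
  code = class↔Fin (suc k)
  open Inverse code using (to; from)
  injective : ∀ {φ ψ : Permutation′ (3 + k)} → to (class φ) ≡ to (class ψ) →
              EqClosure (Replace K) φ ψ
  injective {φ} {ψ} e = lift φ ψ refl
    (subst (λ c → word φ ~ standard c) (Injection.injective (↔⇒↣ code) {class φ} {class ψ} e)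
      (standard-complete φ)
      ◅◅ ~-sym (standard-complete ψ))
    refl
  surjective : ∀ i → ∃[ φ ] ∀ {ψ} → EqClosure (Replace K) ψ φ → to (class ψ) ≡ i
  surjective i with φ , e ← realise (standard-↭ (from i)) =
    φ , λ {ψ} ψ~φ → Inverse.inverseˡ code
      (trans (class-cong ψ φ ψ~φ) (trans (cong (classify (suc k)) e) (classify-standard (from i))))
  count : HasClassCount (KEquivalence K (3 + k)) (size (suc k) * 2)
  count = record
    { to        = to ∘ class
    ; cong      = λ {φ} {ψ} → cong to ∘ class-cong φ ψ
    ; bijective = (λ {φ} {ψ} → injective {φ} {ψ}) , surjective
    }
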